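{- Let $T$ be a tree on at least two vertices with $T \notin \mathcal{T}$. Then $\chi_{td}(T) = \gamma_t(T)+1$ if and only if there exist a minimum total dominating set $D$ of $T$ and a partition $(D_1,D_2)$ of $D$ (i.e. $D = D_1\cup D_2$, $D_1\cap D_2=\emptyset$) such that: (a) $D_2 \subseteq D_I$, where $D_I=\{u\in D : |\mathrm{pn}(u,D)|=1\}$; (b) $T$ contains no vertex $v$ with $|N_T(v)\cap D|\ge 2$ and $N_T(v)\cap D\subseteq D_2$; (c) the set $V(T)\setminus (D_1\cup N[S])$ is independent, where $S=\bigcup_{v\in D_2}\mathrm{pn}(v,D)$ and $N[S]=\bigcup_{s\in S}N_T[s]$.
   Context: All graphs are finite, simple, undirected and have no isolated vertices. A vertex $u$ totally dominates $w\neq u$ if $uw$ is an edge. A total dominating set (TD-set) of $G$ is a set $D\subseteq V(G)$ such that every vertex of $G$ has a neighbour in $D$; $\gamma_t(G)$ is the minimum size of a TD-set. A total dominator coloring (TD-coloring) of $G$ is a proper vertex coloring such that every vertex is adjacent to all vertices of some color class (necessarily different from its own); $\chi_{td}(G)$ is the minimum number of colors in a TD-coloring. For a TD-set $D$ and $u\in D$, the $D$-private neighbourhood is $\mathrm{pn}(u,D)=\{w\in V : N(w)\cap D=\{u\}\}$. A leaf is a vertex of degree 1 and a support vertex (stem) is a neighbour of a leaf. The family $\mathcal{T}$ consists of $P_2$ together with all trees obtained from $k\ge 1$ disjoint stars, each of order at least three, by adding $k-1$ edges joining leaf vertices of the stars so that the center of each original star remains a support vertex. -}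

module Defs where

open import Data.Nat using (ℕ; zero; suc; _≤_; _≟_)
open import Data.Bool using (Bool; true; false; _∧_; _∨_)
import Data.Bool.Properties as BoolP
open import Data.Fin using (Fin)
open import Data.Fin.Subset using (Subset; _∈_; _∉_; _⊆_; ∣_∣; _∩_; _∪_; ⁅_⁆; ⊥; Nonempty)
open import Data.Vec using (Vec; tabulate; lookup)
import Data.Vec.Properties as VecP
open import Data.List using (List; []; _∷_; _++_; length)
open import Data.List.Relation.Unary.Linked using (Linked)
open import Data.List.Relation.Unary.Unique.Propositional using (Unique)
open import Data.Product using (Σ; ∃; _×_; _,_)
open import Data.Sum using (_⊎_)
open import Relation.Nullary using (¬_; Dec; yes; no)
open import Relation.Nullary.Decidable using (⌊_⌋)
open import Relation.Binary.PropositionalEquality using (_≡_; _≢_)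

record Graph (n : ℕ) : Set where
  field
    adj    : Fin n → Fin n → Bool
    sym    : ∀ u v → adj u v ≡ adj v u
    irrefl : ∀ v → adj v v ≡ false
open Graph public

module _ {n : ℕ} (G : Graph n) where

  Adj : Fin n → Fin n → Set
  Adj u v = adj G u v ≡ true

  N : Fin n → Subset n
  N v = tabulate (adj G v)

  degree : Fin n → ℕ
  degree v = ∣ N v ∣

  data Walk : Fin n → Fin n → Set where
    here : ∀ {u} → Walk u u
    step : ∀ {u w v} → Adj u w → Walk w v → Walk u v

  Connected : Set
  Connected = ∀ u v → Walk u v

  HasCycle : Set
  HasCycle = Σ (Fin n) λ x → Σ (List (Fin n)) λ ys →
    (2 ≤ length ys) × Unique (x ∷ ys) × Linked Adj (x ∷ (ys ++ (x ∷ [])))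

  IsTree : Set
  IsTree = Connected × ¬ HasCycle

  IsTDSet : Subset n → Set
  IsTDSet D = ∀ v → Nonempty (N v ∩ D)

  IsMinTDSet : Subset n → Set
  IsMinTDSet D = IsTDSet D × (∀ D′ → IsTDSet D′ → ∣ D ∣ ≤ ∣ D′ ∣)

  IsGammaT : ℕ → Set
  IsGammaT g = Σ (Subset n) λ D → IsMinTDSet D × ∣ D ∣ ≡ g

  IsProper : {k : ℕ} → (Fin n → Fin k) → Set
  IsProper c = ∀ u v → Adj u v → c u ≢ c v

  IsTDColoring : {k : ℕ} → (Fin n → Fin k) → Set
  IsTDColoring {k} c = IsProper c ×
    (∀ v → Σ (Fin k) λ i → (Σ (Fin n) λ w → c w ≡ i) × (∀ w → c w ≡ i → Adj v w))

  IsChiTD : ℕ → Set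
  IsChiTD k = (Σ (Fin n → Fin k) IsTDColoring) ×
    (∀ m → (c : Fin n → Fin m) → IsTDColoring c → k ≤ m)

  pn : Fin n → Subset n → Subset n
  pn u D = tabulate λ w → ⌊ VecP.≡-dec BoolP._≟_ (N w ∩ D) ⁅ u ⁆ ⌋

  DI : Subset n → Subset n
  DI D = tabulate λ u → lookup D u ∧ ⌊ ∣ pn u D ∣ ≟ 1 ⌋

  InS : Subset n → Subset n → Fin n → Set
  InS D D₂ w = Σ (Fin n) λ v → v ∈ D₂ × w ∈ pn v D

  InNS : Subset n → Subset n → Fin n → Set
  InNS D D₂ x = Σ (Fin n) λ s → InS D D₂ s × (s ≡ x ⊎ Adj s x)

  IsPartition : Subset n → Subset n → Subset n → Set
  IsPartition D D₁ D₂ = (D₁ ∪ D₂ ≡ D) × (D₁ ∩ D₂ ≡ ⊥)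

  CondA : Subset n → Subset n → Set
  CondA D D₂ = D₂ ⊆ DI D

  CondB : Subset n → Subset n → Set
  CondB D D₂ = ¬ (Σ (Fin n) λ v → (2 ≤ ∣ N v ∩ D ∣) × (N v ∩ D ⊆ D₂))

  CondC : Subset n → Subset n → Subset n → Set
  CondC D D₁ D₂ = ∀ x y → x ∉ D₁ → ¬ InNS D D₂ x → y ∉ D₁ → ¬ InNS D D₂ y → ¬ Adj x y

  IsLeaf : Fin n → Set
  IsLeaf v = degree v ≡ 1

  IsSupport : Fin n → Set
  IsSupport v = Σ (Fin n) λ w → Adj v w × IsLeaf w

  -- Tree obtained from k ≥ 1 disjoint stars of order ≥ 3 by adding edges
  -- joining leaves of distinct stars, such that each star center stays a
  -- support vertex.  `ctr v` is the center of the star containing v.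
  -- (Given that G is a tree, the number of added edges is automatically k-1.)
  StarDecomposition : Set
  StarDecomposition = Σ (Fin n → Fin n) λ ctr →
      (∀ v → ctr (ctr v) ≡ ctr v)
    × (∀ u w → ctr u ≡ ctr w → (Adj u w ⇔′ ((u ≡ ctr u × w ≢ ctr w) ⊎ (w ≡ ctr w × u ≢ ctr u))))
    × (∀ c → ctr c ≡ c → Σ (Fin n) λ a → Σ (Fin n) λ b →
          a ≢ b × a ≢ c × b ≢ c × ctr a ≡ c × ctr b ≡ c)
    × (∀ u w → ctr u ≢ ctr w → Adj u w → u ≢ ctr u × w ≢ ctr w)
    × (∀ c → ctr c ≡ c → IsSupport c)
    where
      _⇔′_ : Set → Set → Set
      A ⇔′ B = (A → B) × (B → A)

  -- membership in the family 𝒯 (for a tree G): G = P2 or G has a star decomposition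
  InFamilyT : Set
  InFamilyT = (n ≡ 2) ⊎ StarDecomposition

{-# OPTIONS --safe #-}

-- A tree is grown from a root by attaching leaves one at a time; this makes it bipartite and
-- C₄-free, and undoing the growth greedily yields an open packing of size γₜ.
--
-- χ ≠ γₜ outside 𝒯: in a TD-coloring with γₜ colors, the vertices y of a maximum open packing see
-- γₜ different classes, so each class is the neighbourhood of its y.  The packing is then perfectly
-- matched, and C₄-freeness makes one vertex of each matched pair a leaf, giving the stars.
--
-- (⇐) Color every d ∈ D₁ by itself, the neighbourhood of the unique private neighbour of every
-- d ∈ D₂ by one color, and the remaining vertices by one more color.
--
-- (⇒) Every class dominated by a vertex lies on one side of the bipartition.  If one of the γₜ + 1
-- classes is not dominated, a transversal of the others is D, with D₂ its members in classes of at
-- least two vertices.  Otherwise some side has exactly as many classes as a minimum TD-set has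
-- vertices there; D is a transversal of these classes together with the vertices of the minimum
-- TD-set on the other side, and the remainder in (c) lies on that other side.
module Submission where

open import Defs
open import Data.Bool using (Bool; true; false; not; if_then_else_; _∧_)
import Data.Bool.Properties as BoolP
open import Data.Empty using (⊥-elim)
open import Data.Fin using (Fin; zero; suc; _≟_)
open import Data.Fin.Properties using (any?; all?; ¬∀⟶∃¬; suc-injective)
open import Data.Fin.Subset using (Subset; _∈_; _∉_; _⊆_; ∣_∣; _∩_; _∪_; _-_; ∁; ⁅_⁆; ⊥; ⊤; Nonempty; Empty; inside; outside)
open import Data.Fin.Subset.Properties
import Data.List.Membership.DecPropositional as DecMembership
open import Data.List using (List; []; _∷_; _++_; length)
import Data.List.Membership.Propositional as List
open import Data.List.Membership.Propositional.Properties using (∈-++⁻)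
open import Data.List.Relation.Unary.All using ([])
open import Data.List.Relation.Unary.All.Properties using (¬Any⇒All¬)
open import Data.List.Relation.Unary.AllPairs using ([]; _∷_)
open import Data.List.Relation.Unary.Any using (here; there)
open import Data.List.Relation.Unary.Linked using (Linked; [-]; _∷_)
open import Data.List.Relation.Unary.Unique.Propositional using (Unique)
open import Data.Nat using (ℕ; zero; suc; _+_; _≤_; _<_; z≤n; s≤s; s≤s⁻¹; _≤?_)
import Data.Nat.Properties as ℕ
open import Data.Product using (Σ; ∃; _×_; _,_; proj₁; proj₂)
open import Data.Sum using (_⊎_; inj₁; inj₂; [_,_]′)
open import Data.Vec using ([]; _∷_; here; there; tabulate; lookup)
open import Data.Vec.Properties using (lookup∘tabulate; lookup⇒[]=; []=⇒lookup)
open import Function.Base using (_∘_; id)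
open import Function.Bundles using (_⇔_; mk⇔)
open import Relation.Binary.PropositionalEquality as ≡ using (_≡_; _≢_; refl; trans; cong; subst)
open import Relation.Nullary using (¬_; Dec; yes; no; contradiction)
open import Relation.Nullary.Decidable using (⌊_⌋; _×-dec_; _→-dec_; _⊎-dec_; ¬?; toSum; decidable-stable)

-- Finite subsets

⌊⌋-true⁻ : ∀ {P : Set} (P? : Dec P) → ⌊ P? ⌋ ≡ true → P
⌊⌋-true⁻ (yes p) _ = p

⌊⌋-true⁺ : ∀ {P : Set} (P? : Dec P) → P → ⌊ P? ⌋ ≡ true
⌊⌋-true⁺ (yes _) _ = refl
⌊⌋-true⁺ (no ¬p) p = contradiction p ¬p

module _ {n : ℕ} where

  ∈-tabulate⁺ : ∀ (f : Fin n → Bool) {x} → f x ≡ true → x ∈ tabulate f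
  ∈-tabulate⁺ f {x} fx = lookup⇒[]= x _ (trans (lookup∘tabulate f x) fx)

  ∈-tabulate⁻ : ∀ (f : Fin n → Bool) {x} → x ∈ tabulate f → f x ≡ true
  ∈-tabulate⁻ f {x} x∈ = trans (≡.sym (lookup∘tabulate f x)) ([]=⇒lookup x∈)

  module _ {P : Fin n → Set} (P? : ∀ x → Dec (P x)) where

    ⟪_⟫ : Subset n
    ⟪_⟫ = tabulate (λ x → ⌊ P? x ⌋)

    ∈⟪⟫⁺ : ∀ {x} → P x → x ∈ ⟪_⟫
    ∈⟪⟫⁺ {x} p = ∈-tabulate⁺ _ (⌊⌋-true⁺ (P? x) p)

    ∈⟪⟫⁻ : ∀ {x} → x ∈ ⟪_⟫ → P x
    ∈⟪⟫⁻ {x} x∈ = ⌊⌋-true⁻ (P? x) (∈-tabulate⁻ _ x∈)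

∣p∪q∣+∣p∩q∣≡∣p∣+∣q∣ : ∀ {n} (p q : Subset n) → ∣ p ∪ q ∣ + ∣ p ∩ q ∣ ≡ ∣ p ∣ + ∣ q ∣
∣p∪q∣+∣p∩q∣≡∣p∣+∣q∣ [] [] = refl
∣p∪q∣+∣p∩q∣≡∣p∣+∣q∣ (outside ∷ p) (outside ∷ q) = ∣p∪q∣+∣p∩q∣≡∣p∣+∣q∣ p q
∣p∪q∣+∣p∩q∣≡∣p∣+∣q∣ (inside ∷ p) (outside ∷ q) = cong suc (∣p∪q∣+∣p∩q∣≡∣p∣+∣q∣ p q)
∣p∪q∣+∣p∩q∣≡∣p∣+∣q∣ (outside ∷ p) (inside ∷ q) =
  trans (cong suc (∣p∪q∣+∣p∩q∣≡∣p∣+∣q∣ p q)) (≡.sym (ℕ.+-suc ∣ p ∣ ∣ q ∣))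
∣p∪q∣+∣p∩q∣≡∣p∣+∣q∣ (inside ∷ p) (inside ∷ q) =
  cong suc (trans (ℕ.+-suc ∣ p ∪ q ∣ ∣ p ∩ q ∣)
    (trans (cong suc (∣p∪q∣+∣p∩q∣≡∣p∣+∣q∣ p q)) (≡.sym (ℕ.+-suc ∣ p ∣ ∣ q ∣))))

∣p∪q∣≤∣p∣+∣q∣ : ∀ {n} (p q : Subset n) → ∣ p ∪ q ∣ ≤ ∣ p ∣ + ∣ q ∣
∣p∪q∣≤∣p∣+∣q∣ p q = subst (∣ p ∪ q ∣ ≤_) (∣p∪q∣+∣p∩q∣≡∣p∣+∣q∣ p q) (ℕ.m≤m+n _ _)

disjoint⇒∣p∣+∣q∣≤∣p∪q∣ : ∀ {n} (p q : Subset n) → (∀ {x} → x ∈ p → x ∉ q) → ∣ p ∣ + ∣ q ∣ ≤ ∣ p ∪ q ∣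
disjoint⇒∣p∣+∣q∣≤∣p∪q∣ {n} p q disj = ℕ.≤-reflexive
  (trans (≡.sym (∣p∪q∣+∣p∩q∣≡∣p∣+∣q∣ p q)) (trans (cong (∣ p ∪ q ∣ +_) ∣p∩q∣≡0) (ℕ.+-identityʳ _)))
  where
  ∣p∩q∣≡0 : ∣ p ∩ q ∣ ≡ 0
  ∣p∩q∣≡0 = trans (cong ∣_∣ (Empty-unique (λ (x , x∈) → let a , b = x∈p∩q⁻ p q x∈ in disj a b))) (∣⊥∣≡0 n)

-- Induction on `p`: the image of its first element is removed from `q`, and injectivity keeps the
-- other images away from it.
injectiveOn⇒∣p∣≤∣q∣ : ∀ {m n} (p : Subset m) (q : Subset n) (f : Fin m → Fin n) →
  (∀ {x} → x ∈ p → f x ∈ q) → (∀ {x y} → x ∈ p → y ∈ p → f x ≡ f y → x ≡ y) → ∣ p ∣ ≤ ∣ q ∣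
injectiveOn⇒∣p∣≤∣q∣ [] q f into inj = z≤n
injectiveOn⇒∣p∣≤∣q∣ (outside ∷ p) q f into inj =
  injectiveOn⇒∣p∣≤∣q∣ p q (f ∘ suc) (into ∘ there) (λ a b e → suc-injective (inj (there a) (there b) e))
injectiveOn⇒∣p∣≤∣q∣ (inside ∷ p) q f into inj =
  ℕ.≤-<-trans
    (injectiveOn⇒∣p∣≤∣q∣ p (q - f zero) (f ∘ suc)
      (λ a → x∈p∧x≢y⇒x∈p-y (into (there a)) (λ e → contradiction (inj (there a) here e) λ ()))
      (λ a b e → suc-injective (inj (there a) (there b) e)))
    (x∈p⇒∣p-x∣<∣p∣ (into here))

index : ∀ {n} (p : Subset n) {x} → x ∈ p → Fin ∣ p ∣
index (inside ∷ p) here = zero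
index (inside ∷ p) (there x∈p) = suc (index p x∈p)
index (outside ∷ p) (there x∈p) = index p x∈p

-- Lets values of `index` be compared when the membership proofs behind them differ.
∈-irrelevant : ∀ {n} {p : Subset n} {x} (a b : x ∈ p) → a ≡ b
∈-irrelevant here here = refl
∈-irrelevant (there a) (there b) = cong there (∈-irrelevant a b)

index-injective : ∀ {n} (p : Subset n) {x y} (x∈p : x ∈ p) (y∈p : y ∈ p) → index p x∈p ≡ index p y∈p → x ≡ y
index-injective (inside ∷ p) here here e = refl
index-injective (inside ∷ p) (there a) (there b) e = cong suc (index-injective p a b (suc-injective e))
index-injective (outside ∷ p) (there a) (there b) e = cong suc (index-injective p a b e)

singleton-unique : ∀ {n} {p : Subset n} {x} → x ∈ p → (∀ {y} → y ∈ p → y ≡ x) → p ≡ ⁅ x ⁆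
singleton-unique {p = p} {x} x∈p only = ⊆-antisym
  (λ y∈p → subst (_∈ ⁅ x ⁆) (≡.sym (only y∈p)) (x∈⁅x⁆ x))
  (λ y∈ → subst (_∈ p) (≡.sym (x∈⁅y⁆⇒x≡y x y∈)) x∈p)

two-elements⇒2≤∣p∣ : ∀ {n} {p : Subset n} {x y} → x ∈ p → y ∈ p → x ≢ y → 2 ≤ ∣ p ∣
two-elements⇒2≤∣p∣ {p = p} {x} {y} x∈p y∈p x≢y =
  ℕ.≤-trans (s≤s (ℕ.≤-trans (s≤s z≤n) (x∈p⇒∣p-x∣<∣p∣ (x∈p∧x≢y⇒x∈p-y x∈p x≢y)))) (x∈p⇒∣p-x∣<∣p∣ y∈p)

∣p∣<2⇒unique : ∀ {n} {p : Subset n} {x y} → ∣ p ∣ < 2 → x ∈ p → y ∈ p → x ≡ y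
∣p∣<2⇒unique {x = x} {y} small x∈p y∈p with x ≟ y
... | yes x≡y = x≡y
... | no x≢y = contradiction (two-elements⇒2≤∣p∣ x∈p y∈p x≢y) (ℕ.<⇒≱ small)

∉⇒∣p∣<n : ∀ {n} {p : Subset n} {x} → x ∉ p → ∣ p ∣ < n
∉⇒∣p∣<n {n} {p} {x} x∉p = subst (∣ p ∣ <_) (∣⊤∣≡n n)
  (ℕ.≤-<-trans (p⊆q⇒∣p∣≤∣q∣ (λ y∈p → x∈p∧x≢y⇒x∈p-y ∈⊤ (λ e → x∉p (subst (_∈ p) e y∈p)))) (x∈p⇒∣p-x∣<∣p∣ (∈⊤ {x = x})))

∧-true⁻ : ∀ {a b} → a ∧ b ≡ true → a ≡ true × b ≡ true
∧-true⁻ {true} {true} _ = refl , refl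

-- Total domination and private neighbours

module _ {n : ℕ} (G : Graph n) where

  Adj-sym : ∀ {u v} → Adj G u v → Adj G v u
  Adj-sym {u} {v} a = trans (sym G v u) a

  Adj-irrefl : ∀ {v} → ¬ Adj G v v
  Adj-irrefl {v} a = contradiction (trans (≡.sym a) (irrefl G v)) λ ()

  Adj⇒≢ : ∀ {u v} → Adj G u v → v ≢ u
  Adj⇒≢ a refl = Adj-irrefl a

  Adj? : ∀ u v → Dec (Adj G u v)
  Adj? u v = adj G u v BoolP.≟ true

  ∈N⁺ : ∀ {u v} → Adj G u v → v ∈ N G u
  ∈N⁺ = ∈-tabulate⁺ _

  ∈N⁻ : ∀ {u v} → v ∈ N G u → Adj G u v
  ∈N⁻ = ∈-tabulate⁻ _

  Dominated : Subset n → Fin n → Set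
  Dominated D v = ∃ λ d → d ∈ D × Adj G v d

  Dominated? : ∀ D v → Dec (Dominated D v)
  Dominated? D v = any? λ d → (d ∈? D) ×-dec Adj? v d

  Dominated⇒Nonempty : ∀ {D v} → Dominated D v → Nonempty (N G v ∩ D)
  Dominated⇒Nonempty (d , d∈D , a) = d , x∈p∩q⁺ (∈N⁺ a , d∈D)

  ∈N∩⁻ : ∀ {D v d} → d ∈ N G v ∩ D → Adj G v d × d ∈ D
  ∈N∩⁻ {D} {v} d∈ = let a , b = x∈p∩q⁻ (N G v) D d∈ in ∈N⁻ a , b

  Nonempty⇒Dominated : ∀ {D v} → Nonempty (N G v ∩ D) → Dominated D v
  Nonempty⇒Dominated (d , d∈) = let a , b = ∈N∩⁻ d∈ in d , b , a

  ∈pn⁺ : ∀ {u D w} → N G w ∩ D ≡ ⁅ u ⁆ → w ∈ pn G u D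
  ∈pn⁺ e = ∈-tabulate⁺ _ (⌊⌋-true⁺ _ e)

  ∈pn⁻ : ∀ {u D w} → w ∈ pn G u D → N G w ∩ D ≡ ⁅ u ⁆
  ∈pn⁻ w∈ = ⌊⌋-true⁻ _ (∈-tabulate⁻ _ w∈)

  pn⇒Adj : ∀ {u D w} → w ∈ pn G u D → Adj G w u
  pn⇒Adj {u} w∈ = proj₁ (∈N∩⁻ (subst (u ∈_) (≡.sym (∈pn⁻ w∈)) (x∈⁅x⁆ u)))

  pn-only : ∀ {u D w d} → w ∈ pn G u D → d ∈ D → Adj G w d → d ≡ u
  pn-only {u} {d = d} w∈ d∈D a = x∈⁅y⁆⇒x≡y u (subst (d ∈_) (∈pn⁻ w∈) (x∈p∩q⁺ (∈N⁺ a , d∈D)))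

  -- By minimality `D - u` leaves some `w` undominated, so `u` is the only neighbour that `w` can
  -- have in `D`.
  minTD⇒private : ∀ {D u} → IsMinTDSet G D → u ∈ D → ∃ λ w → w ∈ pn G u D
  minTD⇒private {D} {u} (td , least) u∈D =
    let w , ¬dom = ¬∀⟶∃¬ n (Dominated (D - u)) (Dominated? (D - u))
                     (λ all → ℕ.<⇒≱ (x∈p⇒∣p-x∣<∣p∣ u∈D) (least _ (Dominated⇒Nonempty ∘ all)))
        only : ∀ {d} → d ∈ N G w ∩ D → d ≡ u
        only {d} d∈ = decidable-stable (d ≟ u) λ d≢u →
          let a , d∈D = ∈N∩⁻ d∈ in ¬dom (d , x∈p∧x≢y⇒x∈p-y d∈D d≢u , a)
        d , d∈ = td w
    in w , ∈pn⁺ (singleton-unique (subst (_∈ N G w ∩ D) (only d∈) d∈) only)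

  ∈DI⁺ : ∀ {D u} → u ∈ D → ∣ pn G u D ∣ ≡ 1 → u ∈ DI G D
  ∈DI⁺ {D} {u} u∈D one = ∈-tabulate⁺ _ (≡.cong₂ _∧_ ([]=⇒lookup u∈D) (⌊⌋-true⁺ _ one))

  ∈DI⁻ : ∀ {D u} → u ∈ DI G D → ∣ pn G u D ∣ ≡ 1
  ∈DI⁻ {D} {u} u∈ = ⌊⌋-true⁻ (∣ pn G u D ∣ ℕ.≟ 1) (proj₂ (∧-true⁻ {lookup D u} (∈-tabulate⁻ _ u∈)))

-- Trees grow from a root by attaching leaves

  data SimplePath : Fin n → Fin n → List (Fin n) → Set where
    single : ∀ {a} → SimplePath a a (a ∷ [])
    cons   : ∀ {a b w xs} → Adj G a w → a List.∉ xs → SimplePath w b xs → SimplePath a b (a ∷ xs)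

  snoc : ∀ {a b v xs} → SimplePath a b xs → Adj G b v → v List.∉ xs → SimplePath a v (xs ++ v ∷ [])
  snoc single b~v v∉ = cons b~v (λ { (here refl) → v∉ (here refl) }) single
  snoc {a} {v = v} (cons {xs = xs} a~w a∉xs P) b~v v∉ = cons a~w a∉ (snoc P b~v (v∉ ∘ there))
    where
    a∉ : a List.∉ xs ++ v ∷ []
    a∉ a∈ with ∈-++⁻ xs a∈
    ... | inj₁ a∈xs = a∉xs a∈xs
    ... | inj₂ (here refl) = v∉ (here refl)

  SimplePath⇒Unique : ∀ {a b xs} → SimplePath a b xs → Unique xs
  SimplePath⇒Unique single = [] ∷ []
  SimplePath⇒Unique (cons _ a∉xs P) = ¬Any⇒All¬ _ a∉xs ∷ SimplePath⇒Unique P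

  SimplePath⇒Linked : ∀ {a b v z xs} → Adj G z a → SimplePath a b xs → Adj G b v →
    Linked (Adj G) (z ∷ xs ++ v ∷ [])
  SimplePath⇒Linked z~a single b~v = z~a ∷ b~v ∷ [-]
  SimplePath⇒Linked z~a (cons a~w _ P) b~v = z~a ∷ SimplePath⇒Linked a~w P b~v

  SimplePath⇒2≤length : ∀ {a b xs} → a ≢ b → SimplePath a b xs → 2 ≤ length xs
  SimplePath⇒2≤length a≢b single = contradiction refl a≢b
  SimplePath⇒2≤length a≢b (cons _ _ single) = s≤s (s≤s z≤n)
  SimplePath⇒2≤length a≢b (cons _ _ (cons _ _ _)) = s≤s (s≤s z≤n)

  close-path : ∀ {a b v xs} → SimplePath a b xs → a ≢ b → v List.∉ xs → Adj G v a → Adj G v b → HasCycle G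
  close-path {v = v} {xs} P a≢b v∉xs v~a v~b =
    v , xs , SimplePath⇒2≤length a≢b P , (¬Any⇒All¬ xs v∉xs ∷ SimplePath⇒Unique P) ,
    SimplePath⇒Linked v~a P (Adj-sym v~b)

  -- The newest vertex is the head. That it has only one older neighbour records acyclicity;
  -- bipartiteness, C₄-freeness and the packing come from this by induction.
  data Grown : List (Fin n) → Set where
    root : ∀ r → Grown (r ∷ [])
    grow : ∀ {L v u} → Grown L → v List.∉ L → u List.∈ L → Adj G v u →
      (∀ {x} → x List.∈ L → Adj G v x → x ≡ u) → Grown (v ∷ L)

  -- The path is kept inside `L` so that a vertex outside `L` is off it and can close it to a cycle.
  Grown-connected : ∀ {L a b} → Grown L → a List.∈ L → b List.∈ L →
    ∃ λ xs → SimplePath a b xs × (∀ {x} → x List.∈ xs → x List.∈ L)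
  Grown-connected (root r) (here refl) (here refl) = _ , single , id
  Grown-connected (grow g v∉ u∈ v~u _) (here refl) (here refl) = _ , single , λ { (here refl) → here refl }
  Grown-connected (grow g v∉ u∈ v~u _) (here refl) (there b∈) =
    let xs , P , ⊆L = Grown-connected g u∈ b∈
    in _ , cons v~u (v∉ ∘ ⊆L) P , λ { (here refl) → here refl ; (there x∈) → there (⊆L x∈) }
  Grown-connected {L = v ∷ L} (grow g v∉ u∈ v~u _) (there a∈) (here refl) =
    let xs , P , ⊆L = Grown-connected g a∈ u∈
    in _ , snoc P (Adj-sym v~u) (v∉ ∘ ⊆L) ,
       λ x∈ → [ there ∘ ⊆L , (λ { (here refl) → here refl }) ]′ (∈-++⁻ xs x∈)
  Grown-connected (grow g v∉ u∈ v~u _) (there a∈) (there b∈) =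
    let xs , P , ⊆L = Grown-connected g a∈ b∈ in xs , P , there ∘ ⊆L

  open DecMembership {A = Fin n} _≟_ using () renaming (_∈?_ to _∈ˡ?_)

  entering-edge : ∀ {L v r} → Walk G v r → v List.∉ L → r List.∈ L →
    ∃ λ a → ∃ λ u → a List.∉ L × u List.∈ L × Adj G a u
  entering-edge here v∉ r∈ = contradiction r∈ v∉
  entering-edge {L} (step {w = w} v~w W) v∉ r∈ with w ∈ˡ? L
  ... | yes w∈ = _ , w , v∉ , w∈ , v~w
  ... | no w∉ = entering-edge W w∉ r∈

  Grown-root : ∀ {L} → Grown L → ∃ λ r → r List.∈ L
  Grown-root (root r) = r , here refl
  Grown-root (grow _ _ _ _ _) = _ , here refl

  Spanning : Set
  Spanning = ∃ λ L → Grown L × (∀ v → v List.∈ L)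

  outside-of : List (Fin n) → Subset n
  outside-of L = ⟪ (λ v → ¬? (v ∈ˡ? L)) ⟫

  tree⇒spanning : IsTree G → Fin n → Spanning
  tree⇒spanning (conn , acyclic) r = extend (root r) n (∣p∣≤n (outside-of (r ∷ [])))
    where
    -- The number `m` bounds the vertices not yet attached and makes the recursion terminate.
    extend : ∀ {L} → Grown L → ∀ m → ∣ outside-of L ∣ ≤ m → Spanning
    extend {L} g m bound with all? (_∈ˡ? L)
    ... | yes full = L , g , full
    ... | no ¬full = go m bound
      where
      r∈ = Grown-root g
      missing = ¬∀⟶∃¬ n (List._∈ L) (_∈ˡ? L) ¬full
      edge = entering-edge (conn (proj₁ missing) (proj₁ r∈)) (proj₂ missing) (proj₂ r∈)
      v = proj₁ edge
      u = proj₁ (proj₂ edge)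
      v∉ = proj₁ (proj₂ (proj₂ edge))
      u∈ = proj₁ (proj₂ (proj₂ (proj₂ edge)))
      v~u = proj₂ (proj₂ (proj₂ (proj₂ edge)))
      only : ∀ {x} → x List.∈ L → Adj G v x → x ≡ u
      only {x} x∈ v~x = decidable-stable (x ≟ u) λ x≢u →
        let xs , P , ⊆L = Grown-connected g x∈ u∈
        in acyclic (close-path P x≢u (v∉ ∘ ⊆L) v~x v~u)
      shrink : ∣ outside-of (v ∷ L) ∣ < ∣ outside-of L ∣
      shrink = p⊂q⇒∣p∣<∣q∣
        ( (λ x∈ → ∈⟪⟫⁺ _ (∈⟪⟫⁻ (λ x → ¬? (x ∈ˡ? (v ∷ L))) x∈ ∘ there))
        , v , ∈⟪⟫⁺ _ v∉ , λ v∈ → ∈⟪⟫⁻ (λ x → ¬? (x ∈ˡ? (v ∷ L))) v∈ (here refl) )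
      go : ∀ m → ∣ outside-of L ∣ ≤ m → Spanning
      go zero b = contradiction (ℕ.<-≤-trans shrink b) λ ()
      go (suc m) b = extend (grow g v∉ u∈ v~u only) m (s≤s⁻¹ (ℕ.<-≤-trans shrink b))

  -- A new vertex has one older neighbour `u`, so it can take the side opposite to `u`.
  Grown-bipartite : ∀ {L} → Grown L → ∃ λ (side : Fin n → Bool) →
    ∀ {x y} → x List.∈ L → y List.∈ L → Adj G x y → side x ≡ not (side y)
  Grown-bipartite (root r) = (λ _ → true) , λ { (here refl) (here refl) a → contradiction a Adj-irrefl }
  Grown-bipartite {L = v ∷ L} (grow {u = u} g v∉ u∈ v~u only) = side′ , proper
    where
    side = proj₁ (Grown-bipartite g)
    side′ : Fin n → Bool
    side′ x = if ⌊ x ≟ v ⌋ then not (side u) else side x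
    side′-v : side′ v ≡ not (side u)
    side′-v with v ≟ v
    ... | yes _ = refl
    ... | no v≢v = contradiction refl v≢v
    side′-old : ∀ {x} → x List.∈ L → side′ x ≡ side x
    side′-old {x} x∈ with x ≟ v
    ... | yes refl = contradiction x∈ v∉
    ... | no _ = refl
    proper : ∀ {x y} → x List.∈ v ∷ L → y List.∈ v ∷ L → Adj G x y → side′ x ≡ not (side′ y)
    proper (here refl) (here refl) a = contradiction a Adj-irrefl
    proper (here refl) (there y∈) a with only y∈ a
    ... | refl = trans side′-v (cong not (≡.sym (side′-old u∈)))
    proper (there x∈) (here refl) a with only x∈ (Adj-sym a)
    ... | refl = trans (side′-old u∈) (trans (≡.sym (BoolP.not-involutive _)) (cong not (≡.sym side′-v)))
    proper (there x∈) (there y∈) a =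
      trans (side′-old x∈) (trans (proj₂ (Grown-bipartite g) x∈ y∈ a) (cong not (≡.sym (side′-old y∈))))

  -- The vertex of a 4-cycle attached last would have two earlier neighbours.
  Grown-C₄-free : ∀ {L a b x y} → Grown L → a List.∈ L → b List.∈ L → x List.∈ L → y List.∈ L →
    Adj G a x → Adj G a y → Adj G b x → Adj G b y → x ≢ y → a ≡ b
  Grown-C₄-free (root r) (here refl) (here refl) _ _ _ _ _ _ _ = refl
  Grown-C₄-free (grow g v∉ u∈ v~u only) a∈ b∈ x∈ y∈ ax ay bx by x≢y with a∈ | b∈ | x∈ | y∈
  ... | here refl | here refl | _ | _ = refl
  ... | here refl | _ | here refl | _ = contradiction ax Adj-irrefl
  ... | here refl | _ | _ | here refl = contradiction ay Adj-irrefl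
  ... | here refl | _ | there x∈ | there y∈ = contradiction (trans (only x∈ ax) (≡.sym (only y∈ ay))) x≢y
  ... | _ | here refl | here refl | _ = contradiction bx Adj-irrefl
  ... | _ | here refl | _ | here refl = contradiction by Adj-irrefl
  ... | _ | here refl | there x∈ | there y∈ = contradiction (trans (only x∈ bx) (≡.sym (only y∈ by))) x≢y
  ... | there a∈ | there b∈ | here refl | _ = trans (only a∈ (Adj-sym ax)) (≡.sym (only b∈ (Adj-sym bx)))
  ... | there a∈ | there b∈ | _ | here refl = trans (only a∈ (Adj-sym ay)) (≡.sym (only b∈ (Adj-sym by)))
  ... | there a∈ | there b∈ | there x∈ | there y∈ = Grown-C₄-free g a∈ b∈ x∈ y∈ ax ay bx by x≢y

  -- Open packings as large as a total dominating set

  OpenPacking : Subset n → Set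
  OpenPacking Y = ∀ {y y′ z} → y ∈ Y → y′ ∈ Y → Adj G y z → Adj G y′ z → y ≡ y′

  -- True at every stage of the growth of the whole tree, because a vertex attached after `L` has
  -- just one neighbour older than itself.
  OneInside : List (Fin n) → Set
  OneInside L = ∀ {z a b} → z List.∉ L → a List.∈ L → b List.∈ L → Adj G z a → Adj G z b → a ≡ b

  OneInside-shrink : ∀ {L v u} → (∀ {x} → x List.∈ L → Adj G v x → x ≡ u) → OneInside (v ∷ L) → OneInside L
  OneInside-shrink {v = v} only later {z} z∉ a∈ b∈ za zb with z ≟ v
  ... | yes refl = trans (only a∈ za) (≡.sym (only b∈ zb))
  ... | no z≢v = later (λ { (here e) → z≢v e ; (there z∈) → z∉ z∈ }) (there a∈) (there b∈) za zb

  -- Undoing the growth, an undominated vertex v is put into Y and its attaching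
  -- neighbour u into D: a later element of Y sharing a neighbour with v could
  -- only share u, which dominates it.
  greedy : ∀ {L} → Grown L → (∀ v → ∃ λ w → Adj G v w) →
    OneInside L → ∀ D → ∃ λ D′ → ∃ λ Y → D ⊆ D′ × (∀ {x} → x List.∈ L → Dominated D′ x) × ∣ D′ ∣ ≤ ∣ D ∣ + ∣ Y ∣ ×
      (∀ {y} → y ∈ Y → y List.∈ L × ¬ Dominated D y) × OpenPacking Y
  greedy (root r) nbr later D with Dominated? D r
  ... | yes dom = D , ⊥ , id , (λ { (here refl) → dom }) , ℕ.m≤m+n _ _ ,
        (λ y∈ → contradiction y∈ ∉⊥) , λ y∈ → contradiction y∈ ∉⊥
  ... | no ¬dom = D ∪ ⁅ w ⁆ , ⁅ r ⁆ , p⊆p∪q ⁅ w ⁆ ,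
        (λ { (here refl) → w , q⊆p∪q D ⁅ w ⁆ (x∈⁅x⁆ w) , proj₂ (nbr r) }) ,
        ℕ.≤-trans (∣p∪q∣≤∣p∣+∣q∣ D ⁅ w ⁆)
          (ℕ.≤-reflexive (cong (∣ D ∣ +_) (trans (∣⁅x⁆∣≡1 w) (≡.sym (∣⁅x⁆∣≡1 r))))) ,
        (λ y∈ → subst (λ y → y List.∈ r ∷ [] × ¬ Dominated D y) (≡.sym (x∈⁅y⁆⇒x≡y r y∈)) (here refl , ¬dom)) ,
        λ y∈ y′∈ _ _ → trans (x∈⁅y⁆⇒x≡y r y∈) (≡.sym (x∈⁅y⁆⇒x≡y r y′∈))
    where w = proj₁ (nbr r)
  greedy {L = v ∷ L} (grow {u = u} g v∉ u∈ v~u only) nbr later D with Dominated? D v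
  ... | yes (d , d∈D , v~d) =
    let D′ , Y , D⊆D′ , dom , size , Y⊆ , pack = greedy g nbr (OneInside-shrink only later) D
    in D′ , Y , D⊆D′ , (λ { (here refl) → d , D⊆D′ d∈D , v~d ; (there x∈) → dom x∈ }) , size ,
       (λ y∈ → let y∈L , ¬dom = Y⊆ y∈ in there y∈L , ¬dom) , pack
  ... | no ¬dom = D′ , ⁅ v ⁆ ∪ Y , D⊆D′ ∘ p⊆p∪q ⁅ u ⁆ ,
       (λ { (here refl) → u , D⊆D′ (q⊆p∪q D ⁅ u ⁆ (x∈⁅x⁆ u)) , v~u ; (there x∈) → dom x∈ }) ,
       size′ , Y⊆′ , pack′
    where
    rec = greedy g nbr (OneInside-shrink only later) (D ∪ ⁅ u ⁆)
    D′ = proj₁ rec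
    Y = proj₁ (proj₂ rec)
    D⊆D′ = proj₁ (proj₂ (proj₂ rec))
    dom = proj₁ (proj₂ (proj₂ (proj₂ rec)))
    size = proj₁ (proj₂ (proj₂ (proj₂ (proj₂ rec))))
    Y⊆ = proj₁ (proj₂ (proj₂ (proj₂ (proj₂ (proj₂ rec)))))
    pack : OpenPacking Y
    pack = proj₂ (proj₂ (proj₂ (proj₂ (proj₂ (proj₂ rec)))))
    size′ : ∣ D′ ∣ ≤ ∣ D ∣ + ∣ ⁅ v ⁆ ∪ Y ∣
    size′ = begin
      ∣ D′ ∣                      ≤⟨ size ⟩
      ∣ D ∪ ⁅ u ⁆ ∣ + ∣ Y ∣       ≤⟨ ℕ.+-monoˡ-≤ ∣ Y ∣ (∣p∪q∣≤∣p∣+∣q∣ D ⁅ u ⁆) ⟩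
      ∣ D ∣ + ∣ ⁅ u ⁆ ∣ + ∣ Y ∣   ≡⟨ ℕ.+-assoc (∣ D ∣) (∣ ⁅ u ⁆ ∣) (∣ Y ∣) ⟩
      -- The new dominating vertex `u` is paid for by the new packing vertex `v`.
      ∣ D ∣ + (∣ ⁅ u ⁆ ∣ + ∣ Y ∣) ≡⟨ cong (λ m → ∣ D ∣ + (m + ∣ Y ∣)) (trans (∣⁅x⁆∣≡1 u) (≡.sym (∣⁅x⁆∣≡1 v))) ⟩
      ∣ D ∣ + (∣ ⁅ v ⁆ ∣ + ∣ Y ∣) ≤⟨ ℕ.+-monoʳ-≤ ∣ D ∣ (disjoint⇒∣p∣+∣q∣≤∣p∪q∣ ⁅ v ⁆ Y
                                      (λ x∈ x∈Y → v∉ (subst (List._∈ L) (x∈⁅y⁆⇒x≡y v x∈) (proj₁ (Y⊆ x∈Y))))) ⟩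
      ∣ D ∣ + ∣ ⁅ v ⁆ ∪ Y ∣       ∎
      where open ℕ.≤-Reasoning
    Y⊆′ : ∀ {y} → y ∈ ⁅ v ⁆ ∪ Y → y List.∈ v ∷ L × ¬ Dominated D y
    Y⊆′ y∈ with x∈p∪q⁻ ⁅ v ⁆ Y y∈
    ... | inj₁ y∈v with x∈⁅y⁆⇒x≡y v y∈v
    ... | refl = here refl , ¬dom
    Y⊆′ y∈ | inj₂ y∈Y = there (proj₁ (Y⊆ y∈Y)) ,
      λ (d , d∈ , a) → proj₂ (Y⊆ y∈Y) (d , p⊆p∪q ⁅ u ⁆ d∈ , a)
    no-common : ∀ {y z} → y ∈ Y → Adj G v z → ¬ Adj G y z
    no-common {y} {z} y∈ vz yz with z ∈ˡ? L
    ... | yes z∈ with only z∈ vz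
    ... | refl = proj₂ (Y⊆ y∈) (u , q⊆p∪q D ⁅ u ⁆ (x∈⁅x⁆ u) , yz)
    -- Here `z` is newer than `v`, so `OneInside` would make its neighbours `v` and `y` coincide,
    -- although `y` is older than `v`.
    no-common {y} {z} y∈ vz yz | no z∉ = v∉ (subst (List._∈ L) (≡.sym v≡y) (proj₁ (Y⊆ y∈)))
      where
      v≡y = later {z} (λ { (here refl) → Adj-irrefl vz ; (there z∈) → z∉ z∈ }) (here refl) (there (proj₁ (Y⊆ y∈)))
              (Adj-sym vz) (Adj-sym yz)
    pack′ : OpenPacking (⁅ v ⁆ ∪ Y)
    pack′ y∈ y′∈ yz y′z with x∈p∪q⁻ ⁅ v ⁆ Y y∈ | x∈p∪q⁻ ⁅ v ⁆ Y y′∈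
    ... | inj₁ p | inj₁ q = trans (x∈⁅y⁆⇒x≡y v p) (≡.sym (x∈⁅y⁆⇒x≡y v q))
    ... | inj₁ p | inj₂ q with x∈⁅y⁆⇒x≡y v p
    ... | refl = contradiction y′z (no-common q yz)
    pack′ y∈ y′∈ yz y′z | inj₂ p | inj₁ q with x∈⁅y⁆⇒x≡y v q
    ... | refl = contradiction yz (no-common p y′z)
    pack′ y∈ y′∈ yz y′z | inj₂ p | inj₂ q = pack p q yz y′z

  -- The greedy choice starts from the empty set on the whole tree, where `OneInside` is vacuous and
  -- the size bound becomes `∣ D ∣ ≤ ∣ Y ∣`.
  tree⇒openPacking : Spanning → (∀ v → ∃ λ w → Adj G v w) →
    ∃ λ D → IsTDSet G D × ∃ λ Y → ∣ D ∣ ≤ ∣ Y ∣ × OpenPacking Y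
  tree⇒openPacking (L , g , full) nbr =
    let D , Y , _ , dom , size , _ , pack = greedy g nbr (λ z∉ → contradiction (full _) z∉) ⊥
    in D , (λ v → Dominated⇒Nonempty (dom (full v))) , Y ,
       subst (λ m → ∣ D ∣ ≤ m + ∣ Y ∣) (∣⊥∣≡0 n) size , pack

  Bipartition : (Fin n → Bool) → Set
  Bipartition side = ∀ {u v} → Adj G u v → side u ≡ not (side v)

  C₄-Free : Set
  C₄-Free = ∀ {a b x y} → Adj G a x → Adj G a y → Adj G b x → Adj G b y → x ≢ y → a ≡ b

  tree⇒bipartition : Spanning → ∃ Bipartition
  tree⇒bipartition (L , g , full) =
    let side , proper = Grown-bipartite g in side , λ {u} {v} → proper (full u) (full v)

  tree⇒C₄-free : Spanning → C₄-Free
  tree⇒C₄-free (L , g , full) {a} {b} {x} {y} = Grown-C₄-free g (full a) (full b) (full x) (full y)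

-- Transversals of a coloring

  module Transversal {k : ℕ} (c : Fin n → Fin k) where

    Dominates : Fin n → Fin k → Set
    Dominates v i = ∀ w → c w ≡ i → Adj G v w

    Dominates? : ∀ v i → Dec (Dominates v i)
    Dominates? v i = all? λ w → (c w ≟ i) →-dec Adj? v w

    -- The default value is returned for the unused colors.
    pick : Fin n → Fin k → Fin n
    pick v₀ i with any? (λ v → c v ≟ i)
    ... | yes (v , _) = v
    ... | no _ = v₀

    pick-color : ∀ v₀ v → c (pick v₀ (c v)) ≡ c v
    pick-color v₀ v with any? (λ w → c w ≟ c v)
    ... | yes (_ , e) = e
    ... | no ∄ = contradiction (v , refl) ∄

    module _ (rep : Fin k → Fin n) (C : Subset k) where

      Chosen : Fin n → Set
      Chosen v = c v ∈ C × rep (c v) ≡ v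

      Chosen? : ∀ v → Dec (Chosen v)
      Chosen? v = (c v ∈? C) ×-dec (rep (c v) ≟ v)

      reps : Subset n
      reps = ⟪ Chosen? ⟫

      ∣reps∣≤∣C∣ : ∣ reps ∣ ≤ ∣ C ∣
      ∣reps∣≤∣C∣ = injectiveOn⇒∣p∣≤∣q∣ reps C c (proj₁ ∘ ∈⟪⟫⁻ Chosen?) λ x∈ y∈ e →
        trans (≡.sym (proj₂ (∈⟪⟫⁻ Chosen? x∈))) (trans (cong rep e) (proj₂ (∈⟪⟫⁻ Chosen? y∈)))

      rep∈reps : (∀ v → c (rep (c v)) ≡ c v) → ∀ {v} → c v ∈ C → rep (c v) ∈ reps
      rep∈reps rep-color {v} cv∈C =
        ∈⟪⟫⁺ Chosen? (subst (_∈ C) (≡.sym (rep-color v)) cv∈C , cong rep (rep-color v))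

  -- Each vertex sees all of some class, hence the vertex picked from it, so a transversal is
  -- totally dominating.
  TDColoring⇒γ≤k : ∀ {k} {c : Fin n → Fin k} {D} → Fin n → IsTDColoring G c → IsMinTDSet G D → ∣ D ∣ ≤ k
  TDColoring⇒γ≤k {k} {c} {D} v₀ (_ , dom) (_ , least) = ℕ.≤-trans (least R td)
    (ℕ.≤-trans (∣reps∣≤∣C∣ (pick v₀) ⊤) (∣p∣≤n (⊤ {n = k})))
    where
    open Transversal c
    R = reps (pick v₀) ⊤
    td : IsTDSet G R
    td v with dom v
    ... | i , (w , refl) , full = Dominated⇒Nonempty
      (_ , rep∈reps (pick v₀) ⊤ (pick-color v₀) {w} ∈⊤ , full _ (pick-color v₀ w))

-- From colorings to partitions of a minimum total dominating set

  -- Shared by both cases of (⇒): `C` holds the colors whose classes get a representative, and `X`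
  -- serves the vertices that need not dominate such a class.
  module Partitioned {k : ℕ} (c : Fin n → Fin k) (rep : Fin k → Fin n) (C : Subset k) (X : Subset n) where
    open Transversal c

    Repeated : Fin n → Set
    Repeated u = ∃ λ w → w ≢ u × c w ≡ c u

    Repeated? : ∀ u → Dec (Repeated u)
    Repeated? u = any? λ w → ¬? (w ≟ u) ×-dec (c w ≟ c u)

    D D₁ D₂ : Subset n
    D = X ∪ reps rep C
    D₂ = ⟪ (λ u → Chosen? rep C u ×-dec Repeated? u) ⟫
    D₁ = D ∩ ∁ D₂

    ∈D₂⁻ : ∀ {u} → u ∈ D₂ → Chosen rep C u × Repeated u
    ∈D₂⁻ = ∈⟪⟫⁻ (λ u → Chosen? rep C u ×-dec Repeated? u)

    D₂⊆D : D₂ ⊆ D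
    D₂⊆D u∈ = q⊆p∪q X (reps rep C) (∈⟪⟫⁺ (Chosen? rep C) (proj₁ (∈D₂⁻ u∈)))

    isPartition : IsPartition G D D₁ D₂
    isPartition = ⊆-antisym ⊆D D⊆ , Empty-unique empty
      where
      ⊆D : D₁ ∪ D₂ ⊆ D
      ⊆D x∈ = [ p∩q⊆p D (∁ D₂) , D₂⊆D ]′ (x∈p∪q⁻ D₁ D₂ x∈)
      D⊆ : D ⊆ D₁ ∪ D₂
      D⊆ {x} x∈D with x ∈? D₂
      ... | yes x∈D₂ = q⊆p∪q D₁ D₂ x∈D₂
      ... | no x∉D₂ = p⊆p∪q D₂ (x∈p∩q⁺ (x∈D , x∉p⇒x∈∁p x∉D₂))
      empty : Empty (D₁ ∩ D₂)
      empty (x , x∈) = let x∈D₁ , x∈D₂ = x∈p∩q⁻ D₁ D₂ x∈ in x∈∁p⇒x∉p (p∩q⊆q D (∁ D₂) x∈D₁) x∈D₂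

    module _
      (rep-color : ∀ v → c (rep (c v)) ≡ c v)
      (X-off : ∀ {x} → x ∈ X → c x ∉ C)
      (dom : ∀ v → Dominated X v ⊎ ∃ λ w → c w ∈ C × Dominates v (c w))
      (small : ∀ D′ → IsTDSet G D′ → ∣ X ∣ + ∣ C ∣ ≤ ∣ D′ ∣)
      where

      rep∈D : ∀ {v} → c v ∈ C → rep (c v) ∈ D
      rep∈D cv∈C = q⊆p∪q X (reps rep C) (rep∈reps rep C rep-color cv∈C)

      td : IsTDSet G D
      td v with dom v
      ... | inj₁ (d , d∈X , v~d) = Dominated⇒Nonempty (d , p⊆p∪q (reps rep C) d∈X , v~d)
      ... | inj₂ (w , cw∈C , full) = Dominated⇒Nonempty (rep (c w) , rep∈D cw∈C , full _ (rep-color w))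

      minTD : IsMinTDSet G D
      minTD = td , λ D′ td′ → ℕ.≤-trans (∣p∪q∣≤∣p∣+∣q∣ X (reps rep C))
        (ℕ.≤-trans (ℕ.+-monoʳ-≤ ∣ X ∣ (∣reps∣≤∣C∣ rep C)) (small D′ td′))

      -- A neighbour of `w` in `X` would be `u`, whose color is in `C`, against `X-off`. So `w`
      -- dominates a class from `C`; its representative is in `D` and can only be `u`.
      private-dominates : ∀ {u w} → u ∈ D₂ → w ∈ pn G u D → Dominates w (c u)
      private-dominates {u} {w} u∈ w∈ with dom w
      ... | inj₁ (d , d∈X , w~d) with pn-only w∈ (p⊆p∪q (reps rep C) d∈X) w~d
      ... | refl = contradiction (proj₁ (proj₁ (∈D₂⁻ u∈))) (X-off d∈X)
      private-dominates {u} {w} u∈ w∈ | inj₂ (z , cz∈C , full) =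
        subst (Dominates w) (trans (≡.sym (rep-color z)) (cong c rep≡u)) full
        where
        rep≡u : rep (c z) ≡ u
        rep≡u = pn-only w∈ (rep∈D cz∈C) (full _ (rep-color z))

      module _ (C₄-free : C₄-Free) where

        -- The class of `u` has a second vertex, and two dominators would form a 4-cycle with these
        -- two.
        dominator-unique : ∀ {u a b} → u ∈ D₂ → Dominates a (c u) → Dominates b (c u) → a ≡ b
        dominator-unique {u} u∈ p q = let w , w≢u , e = proj₂ (∈D₂⁻ u∈) in
          C₄-free (p w e) (p u refl) (q w e) (q u refl) w≢u

        condA : CondA G D D₂
        condA u∈ = let w , w∈ = minTD⇒private minTD (D₂⊆D u∈) in
          ∈DI⁺ (D₂⊆D u∈) (trans
            (cong ∣_∣ (singleton-unique w∈ λ z∈ →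
              dominator-unique u∈ (private-dominates u∈ z∈) (private-dominates u∈ w∈)))
            (∣⁅x⁆∣≡1 w))

        -- Such a `v` has no neighbour in `X`, so it dominates a class with representative in `D₂`.
        -- It is then the private neighbour of that representative and has only one neighbour in
        -- `D`.
        condB : CondB G D D₂
        condB (v , two , N⊆D₂) with dom v
        ... | inj₁ (d , d∈X , v~d) =
          X-off d∈X (proj₁ (proj₁ (∈D₂⁻ (N⊆D₂ (x∈p∩q⁺ (∈N⁺ v~d , p⊆p∪q (reps rep C) d∈X))))))
        ... | inj₂ (z , cz∈C , full) = ℕ.<⇒≱ (s≤s (s≤s z≤n)) (subst (2 ≤_) one two)
          where
          u∈D₂ : rep (c z) ∈ D₂
          u∈D₂ = N⊆D₂ (x∈p∩q⁺ (∈N⁺ (full _ (rep-color z)) , rep∈D cz∈C))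
          w = minTD⇒private minTD (D₂⊆D u∈D₂)
          v≡w : v ≡ proj₁ w
          v≡w = dominator-unique u∈D₂ (subst (Dominates v) (≡.sym (rep-color z)) full)
                  (private-dominates u∈D₂ (proj₂ w))
          one : ∣ N G v ∩ D ∣ ≡ 1
          one = trans (cong ∣_∣ (∈pn⁻ (subst (_∈ pn G _ D) (≡.sym v≡w) (proj₂ w)))) (∣⁅x⁆∣≡1 (rep (c z)))

        -- If the color of `x` were in `C`, then either its representative is in `D₂`, and `x` is
        -- adjacent to the private neighbour of it, or the class is a singleton and `x` is in `D₁`.
        uncovered : ∀ {x} → x ∉ D₁ → ¬ InNS G D D₂ x → c x ∉ C
        uncovered {x} x∉D₁ ¬ns cx∈C with rep (c x) ∈? D₂
        ... | yes u∈D₂ = let w , w∈ = minTD⇒private minTD (D₂⊆D u∈D₂) in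
          ¬ns (w , (rep (c x) , u∈D₂ , w∈) , inj₂ (private-dominates u∈D₂ w∈ x (≡.sym (rep-color x))))
        ... | no u∉D₂ with x ≟ rep (c x)
        ... | yes x≡u = x∉D₁ (subst (_∈ D₁) (≡.sym x≡u) (x∈p∩q⁺ (rep∈D cx∈C , x∉p⇒x∈∁p u∉D₂)))
        ... | no x≢u = u∉D₂ (∈⟪⟫⁺ _
          ( (subst (_∈ C) (≡.sym (rep-color x)) cx∈C , cong rep (rep-color x))
          , x , x≢u , ≡.sym (rep-color x)))

        condC : (∀ {u v} → c u ∉ C → c v ∉ C → ¬ Adj G u v) → CondC G D D₁ D₂
        condC ind x y x∉ ¬nsx y∉ ¬nsy = ind (uncovered x∉ ¬nsx) (uncovered y∉ ¬nsy)

  GoodPartition : Set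
  GoodPartition = Σ (Subset n) λ D → IsMinTDSet G D × Σ (Subset n) λ D₁ → Σ (Subset n) λ D₂ →
    IsPartition G D D₁ D₂ × CondA G D D₂ × CondB G D D₂ × CondC G D D₁ D₂

  module FromColoring {g : ℕ} (v₀ : Fin n) (side : Fin n → Bool) (bip : Bipartition side) (C₄-free : C₄-Free)
    (c : Fin n → Fin (suc g)) (isTDColoring : IsTDColoring G c)
    {D₀ : Subset n} (td₀ : IsTDSet G D₀) (least : ∀ D → IsTDSet G D → ∣ D₀ ∣ ≤ ∣ D ∣) (∣D₀∣≡g : ∣ D₀ ∣ ≡ g)
    where
    open Transversal c

    rep = pick v₀
    rep-color = pick-color v₀

    γ≤ : ∀ {m} → m ≤ g → ∀ D → IsTDSet G D → m ≤ ∣ D ∣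
    γ≤ m≤g D td = ℕ.≤-trans (ℕ.≤-trans m≤g (ℕ.≤-reflexive (≡.sym ∣D₀∣≡g))) (least D td)

    -- The side `b` is that of the dominating vertex, so the class lies on the opposite side.
    -- Requiring the class to be inhabited makes `Col true` and `Col false` disjoint.
    DominatedFrom : Bool → Fin (suc g) → Set
    DominatedFrom b i = (∃ λ w → c w ≡ i) × ∃ λ v → side v ≡ b × Dominates v i

    DominatedFrom? : ∀ b i → Dec (DominatedFrom b i)
    DominatedFrom? b i = any? (λ w → c w ≟ i) ×-dec any? (λ v → (side v BoolP.≟ b) ×-dec Dominates? v i)

    Col : Bool → Subset (suc g)
    Col b = ⟪ DominatedFrom? b ⟫

    X : Bool → Subset n
    X b = ⟪ (λ d → (d ∈? D₀) ×-dec (side d BoolP.≟ b)) ⟫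

    ∈X⁻ : ∀ {b d} → d ∈ X b → d ∈ D₀ × side d ≡ b
    ∈X⁻ {b} = ∈⟪⟫⁻ (λ d → (d ∈? D₀) ×-dec (side d BoolP.≟ b))

    Col-side : ∀ {b w} → c w ∈ Col b → side w ≡ not b
    Col-side {b} {w} cw∈ with ∈⟪⟫⁻ (DominatedFrom? b) cw∈
    ... | _ , v , refl , full = bip (Adj-sym (full w refl))

    not-both : ∀ {b w} → c w ∈ Col b → c w ∉ Col (not b)
    not-both p q = BoolP.not-¬ (Col-side p) (Col-side q)

    Col-disjoint : ∀ {i} → i ∈ Col true → i ∉ Col false
    Col-disjoint p q with proj₁ (∈⟪⟫⁻ (DominatedFrom? true) p)
    ... | w , refl = not-both p q

    own-color : ∀ v → ∃ λ w → c w ∈ Col (side v) × Dominates v (c w)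
    own-color v with proj₂ isTDColoring v
    ... | i , (w , refl) , full = w , ∈⟪⟫⁺ (DominatedFrom? (side v)) ((w , refl) , v , refl , full) , full

    -- A vertex on side `b` dominates a class from `Col b`; any other vertex has a neighbour in
    -- `D₀`, which lies on side `b`.
    dom : ∀ b v → Dominated (X b) v ⊎ ∃ λ w → c w ∈ Col b × Dominates v (c w)
    dom b v with side v BoolP.≟ b
    ... | yes refl = inj₂ (own-color v)
    ... | no v≢b = let d , d∈D₀ , v~d = Nonempty⇒Dominated (td₀ v) in
      inj₁ (d , ∈⟪⟫⁺ _ (d∈D₀ , trans (bip (Adj-sym v~d)) (≡.sym (BoolP.¬-not (v≢b ∘ ≡.sym)))) , v~d)

    Both : Subset (suc g)
    Both = Col true ∪ Col false

    Col⊆Both : ∀ b → Col b ⊆ Both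
    Col⊆Both true = p⊆p∪q (Col false)
    Col⊆Both false = q⊆p∪q (Col true) (Col false)

    ∣Col∣+∣Col∣≤∣Both∣ : ∣ Col true ∣ + ∣ Col false ∣ ≤ ∣ Both ∣
    ∣Col∣+∣Col∣≤∣Both∣ = disjoint⇒∣p∣+∣q∣≤∣p∪q∣ (Col true) (Col false) Col-disjoint

    domBoth : ∀ v → Dominated ⊥ v ⊎ ∃ λ w → c w ∈ Both × Dominates v (c w)
    domBoth v = let w , cw∈ , full = own-color v in inj₂ (w , Col⊆Both (side v) cw∈ , full)

    -- At most one color is dominated by no vertex; its class is the independent remainder.
    spare-color : ∣ Col true ∣ + ∣ Col false ∣ ≤ g → GoodPartition
    spare-color bound =
      D , minTD rep-color off domBoth small , D₁ , D₂ , isPartition ,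
      condA rep-color off domBoth small C₄-free , condB rep-color off domBoth small C₄-free ,
      condC rep-color off domBoth small C₄-free ind
      where
      open Partitioned c rep Both ⊥
      off : ∀ {x} → x ∈ ⊥ → c x ∉ Both
      off x∈ = contradiction x∈ ∉⊥
      small : ∀ D′ → IsTDSet G D′ → ∣ ⊥ {n = n} ∣ + ∣ Both ∣ ≤ ∣ D′ ∣
      small = γ≤ (subst (λ m → m + ∣ Both ∣ ≤ g) (≡.sym (∣⊥∣≡0 n))
        (ℕ.≤-trans (∣p∪q∣≤∣p∣+∣q∣ (Col true) (Col false)) bound))
      -- A transversal of the classes in `Both` is totally dominating, so at most one of the `suc g`
      -- colors is missing from `Both`.
      g≤∣Both∣ : g ≤ ∣ Both ∣
      g≤∣Both∣ = subst (_≤ ∣ Both ∣) ∣D₀∣≡g (ℕ.≤-trans (least D (td rep-color off domBoth small))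
        (ℕ.≤-trans (∣p∪q∣≤∣p∣+∣q∣ ⊥ (reps rep Both))
          (subst (λ m → m + ∣ reps rep Both ∣ ≤ ∣ Both ∣) (≡.sym (∣⊥∣≡0 n)) (∣reps∣≤∣C∣ rep Both))))
      -- Adjacent vertices would contribute two different missing colors.
      ind : ∀ {u v} → c u ∉ Both → c v ∉ Both → ¬ Adj G u v
      ind {u} {v} u∉ v∉ u~v = ℕ.<⇒≱ (ℕ.≤-<-trans g≤∣Both∣ ∣Both∣<) (s≤s⁻¹ (∉⇒∣p∣<n v∉′))
        where
        Both′ = Both ∪ ⁅ c u ⁆
        v∉′ : c v ∉ Both′
        v∉′ v∈ with x∈p∪q⁻ Both ⁅ c u ⁆ v∈
        ... | inj₁ p = v∉ p
        ... | inj₂ p = proj₁ isTDColoring u v u~v (≡.sym (x∈⁅y⁆⇒x≡y (c u) p))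
        ∣Both∣< : ∣ Both ∣ < ∣ Both′ ∣
        ∣Both∣< = p⊂q⇒∣p∣<∣q∣ (p⊆p∪q ⁅ c u ⁆ , c u , q⊆p∪q Both ⁅ c u ⁆ (x∈⁅x⁆ (c u)) , u∉)

    -- A vertex whose color is not in `Col b` has its color in the other family, so the remainder
    -- lies on side `b` and is independent.
    all-dominated : (∀ v → c v ∈ Both) → ∀ b → ∣ X b ∣ + ∣ Col b ∣ ≤ g → GoodPartition
    all-dominated all b bound =
      D , minTD rep-color off (dom b) small , D₁ , D₂ , isPartition ,
      condA rep-color off (dom b) small C₄-free , condB rep-color off (dom b) small C₄-free ,
      condC rep-color off (dom b) small C₄-free ind
      where
      open Partitioned c rep (Col b) (X b)
      small = γ≤ bound
      off : ∀ {x} → x ∈ X b → c x ∉ Col b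
      off x∈ cx∈ = BoolP.not-¬ (proj₂ (∈X⁻ x∈)) (Col-side cx∈)
      other : ∀ b {v} → c v ∈ Both → c v ∉ Col b → side v ≡ b
      other true v∈ v∉ = [ (λ p → contradiction p v∉) , Col-side ]′ (x∈p∪q⁻ (Col true) (Col false) v∈)
      other false v∈ v∉ = [ Col-side , (λ p → contradiction p v∉) ]′ (x∈p∪q⁻ (Col true) (Col false) v∈)
      ind : ∀ {u v} → c u ∉ Col b → c v ∉ Col b → ¬ Adj G u v
      ind {u} {v} u∉ v∉ u~v = BoolP.not-¬ (≡.sym (other b (all v) v∉))
        (trans (≡.sym (other b (all u) u∉)) (bip u~v))

    g≤∣X∣+∣X∣ : g ≤ ∣ X true ∣ + ∣ X false ∣
    g≤∣X∣+∣X∣ = subst (_≤ ∣ X true ∣ + ∣ X false ∣) ∣D₀∣≡g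
      (ℕ.≤-trans (p⊆q⇒∣p∣≤∣q∣ cover) (∣p∪q∣≤∣p∣+∣q∣ (X true) (X false)))
      where
      cover : D₀ ⊆ X true ∪ X false
      cover {d} d∈ with side d in eq
      ... | true = p⊆p∪q (X false) (∈⟪⟫⁺ _ (d∈ , eq))
      ... | false = q⊆p∪q (X true) (X false) (∈⟪⟫⁺ _ (d∈ , eq))

    ∣X∣+∣X∣≤g : ∣ X true ∣ + ∣ X false ∣ ≤ g
    ∣X∣+∣X∣≤g = subst (∣ X true ∣ + ∣ X false ∣ ≤_) ∣D₀∣≡g (ℕ.≤-trans
      (disjoint⇒∣p∣+∣q∣≤∣p∪q∣ (X true) (X false)
        (λ p q → BoolP.not-¬ (proj₂ (∈X⁻ p)) (proj₂ (∈X⁻ q))))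
      (p⊆q⇒∣p∣≤∣q∣ (λ x∈ → [ proj₁ ∘ ∈X⁻ , proj₁ ∘ ∈X⁻ ]′ (x∈p∪q⁻ (X true) (X false) x∈))))

    no-spare-color : ¬ (∣ Col true ∣ + ∣ Col false ∣ ≤ g) → ∀ v → c v ∈ Both
    no-spare-color excess v = decidable-stable (c v ∈? Both) λ v∉ →
      excess (ℕ.≤-trans ∣Col∣+∣Col∣≤∣Both∣ (s≤s⁻¹ (∉⇒∣p∣<n v∉)))

    goodPartition : GoodPartition
    goodPartition with ∣ Col true ∣ + ∣ Col false ∣ ≤? g
    ... | yes bound = spare-color bound
    ... | no excess with ∣ Col true ∣ ≤? ∣ X false ∣ | ∣ Col false ∣ ≤? ∣ X true ∣
    ... | yes p | _ = all-dominated (no-spare-color excess) true (ℕ.≤-trans (ℕ.+-monoʳ-≤ ∣ X true ∣ p) ∣X∣+∣X∣≤g)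
    ... | no _ | yes p = all-dominated (no-spare-color excess) false (ℕ.≤-trans (ℕ.+-monoʳ-≤ ∣ X false ∣ p)
                           (subst (_≤ g) (ℕ.+-comm ∣ X true ∣ ∣ X false ∣) ∣X∣+∣X∣≤g))
    -- Otherwise the two disjoint families would have at least `g + 2` of the `suc g` colors.
    ... | no p | no q = ⊥-elim (ℕ.1+n≰n (begin
      suc (suc g)                                    ≤⟨ s≤s (s≤s g≤∣X∣+∣X∣) ⟩
      suc (suc (∣ X true ∣ + ∣ X false ∣))           ≡⟨ cong (2 +_) (ℕ.+-comm (∣ X true ∣) (∣ X false ∣)) ⟩
      suc (suc (∣ X false ∣ + ∣ X true ∣))           ≡⟨ cong suc (ℕ.+-suc (∣ X false ∣) (∣ X true ∣)) ⟨
      suc (∣ X false ∣) + suc (∣ X true ∣)           ≤⟨ ℕ.+-mono-≤ (ℕ.≰⇒> p) (ℕ.≰⇒> q) ⟩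
      ∣ Col true ∣ + ∣ Col false ∣                   ≤⟨ ∣Col∣+∣Col∣≤∣Both∣ ⟩
      ∣ Both ∣                                       ≤⟨ ∣p∣≤n Both ⟩
      suc g                                          ∎))
      where open ℕ.≤-Reasoning

-- From partitions to colorings

  module ToColoring (side : Fin n → Bool) (bip : Bipartition side) {D D₁ D₂ : Subset n}
    (minTD : IsMinTDSet G D) (D₁∪D₂≡D : D₁ ∪ D₂ ≡ D) (D₁∩D₂≡⊥ : D₁ ∩ D₂ ≡ ⊥)
    (condA : CondA G D D₂) (condB : CondB G D D₂) (condC : CondC G D D₁ D₂)
    where

    D₁⊆D : D₁ ⊆ D
    D₁⊆D {x} x∈ = subst (x ∈_) D₁∪D₂≡D (p⊆p∪q D₂ x∈)

    D₂⊆D : D₂ ⊆ D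
    D₂⊆D {x} x∈ = subst (x ∈_) D₁∪D₂≡D (q⊆p∪q D₁ D₂ x∈)

    disjoint : ∀ {x} → x ∈ D₁ → x ∉ D₂
    disjoint {x} p q = ∉⊥ (subst (x ∈_) D₁∩D₂≡⊥ (x∈p∩q⁺ (p , q)))

    private-unique : ∀ {d w w′} → d ∈ D₂ → w ∈ pn G d D → w′ ∈ pn G d D → w ≡ w′
    private-unique d∈ = ∣p∣<2⇒unique (s≤s (ℕ.≤-reflexive (∈DI⁻ {D} (condA d∈))))

    -- If `v` has no neighbour in `D₁`, its neighbours in `D` all lie in `D₂`, and (b) allows only
    -- one.
    dominator : ∀ v → Dominated D₁ v ⊎ ∃ λ d → d ∈ D₂ × v ∈ pn G d D
    dominator v with Dominated? D₁ v
    ... | yes p = inj₁ p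
    ... | no ¬p = inj₂ (d , N⊆D₂ (proj₂ (proj₁ minTD v)) , ∈pn⁺ (singleton-unique (proj₂ (proj₁ minTD v))
          λ y∈ → ∣p∣<2⇒unique (ℕ.≰⇒> λ two → condB (v , two , N⊆D₂)) y∈ (proj₂ (proj₁ minTD v))))
      where
      d = proj₁ (proj₁ minTD v)
      N⊆D₂ : N G v ∩ D ⊆ D₂
      N⊆D₂ {x} x∈ with ∈N∩⁻ x∈
      ... | v~x , x∈D with x∈p∪q⁻ D₁ D₂ (subst (x ∈_) (≡.sym D₁∪D₂≡D) x∈D)
      ... | inj₁ x∈D₁ = contradiction (x , x∈D₁ , v~x) ¬p
      ... | inj₂ x∈D₂ = x∈D₂

    -- Otherwise a common neighbour z could replace both d and d′ in D.
    private-neighbourhoods-disjoint : ∀ {d d′ w w′ z} → d ∈ D₂ → d′ ∈ D₂ → w ∈ pn G d D → w′ ∈ pn G d′ D →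
      Adj G w z → Adj G w′ z → d ≡ d′
    private-neighbourhoods-disjoint {d} {d′} {w} {w′} {z} d∈ d′∈ w∈ w′∈ w~z w′~z with d ≟ d′
    ... | yes d≡d′ = d≡d′
    ... | no d≢d′ = contradiction (proj₂ minTD E (Dominated⇒Nonempty ∘ td)) (ℕ.<⇒≱ ∣E∣<)
      where
      E = (D - d - d′) ∪ ⁅ z ⁆
      z∈E : z ∈ E
      z∈E = q⊆p∪q (D - d - d′) ⁅ z ⁆ (x∈⁅x⁆ z)
      keep : ∀ {x} → x ∈ D → x ≢ d → x ≢ d′ → x ∈ E
      keep x∈ x≢d x≢d′ = p⊆p∪q ⁅ z ⁆ (x∈p∧x≢y⇒x∈p-y (x∈p∧x≢y⇒x∈p-y x∈ x≢d) x≢d′)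
      ∣E∣< : ∣ E ∣ < ∣ D ∣
      ∣E∣< = begin-strict
        ∣ E ∣                          ≤⟨ ∣p∪q∣≤∣p∣+∣q∣ (D - d - d′) ⁅ z ⁆ ⟩
        ∣ D - d - d′ ∣ + ∣ ⁅ z ⁆ ∣     ≡⟨ cong (∣ D - d - d′ ∣ +_) (∣⁅x⁆∣≡1 z) ⟩
        ∣ D - d - d′ ∣ + 1             ≡⟨ ℕ.+-comm (∣ D - d - d′ ∣) 1 ⟩
        suc (∣ D - d - d′ ∣)           ≤⟨ x∈p⇒∣p-x∣<∣p∣ (x∈p∧x≢y⇒x∈p-y (D₂⊆D d′∈) (d≢d′ ∘ ≡.sym)) ⟩
        ∣ D - d ∣                      <⟨ x∈p⇒∣p-x∣<∣p∣ (D₂⊆D d∈) ⟩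
        ∣ D ∣                          ∎
        where open ℕ.≤-Reasoning
      -- The vertices without a neighbour in `D₁` are private neighbours; by (a) only `w` and `w′`
      -- belong to `d` and `d′`, and both are adjacent to `z`.
      td : ∀ v → Dominated E v
      td v with dominator v
      ... | inj₁ (x , x∈D₁ , v~x) =
        x , keep (D₁⊆D x∈D₁) (λ { refl → disjoint x∈D₁ d∈ }) (λ { refl → disjoint x∈D₁ d′∈ }) , v~x
      ... | inj₂ (x , x∈D₂ , v∈) with x ≟ d | x ≟ d′
      ... | yes refl | _ = z , z∈E , subst (λ v → Adj G v z) (private-unique d∈ w∈ v∈) w~z
      ... | no _ | yes refl = z , z∈E , subst (λ v → Adj G v z) (private-unique d′∈ w′∈ v∈) w′~z
      ... | no x≢d | no x≢d′ = x , keep (D₂⊆D x∈D₂) x≢d x≢d′ , pn⇒Adj v∈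

    -- The color classes are {d} for d ∈ D₁ and N(w) for the private neighbour w of d ∈ D₂;
    -- the unowned vertices form the additional class.
    Owns : Fin n → Fin n → Set
    Owns d v = (d ∈ D₁ × d ≡ v) ⊎ (d ∈ D₂ × ∃ λ w → w ∈ pn G d D × Adj G w v)

    Owns? : ∀ d v → Dec (Owns d v)
    Owns? d v = ((d ∈? D₁) ×-dec (d ≟ v)) ⊎-dec
      ((d ∈? D₂) ×-dec any? λ w → (w ∈? pn G d D) ×-dec Adj? w v)

    owner∈D : ∀ {d v} → Owns d v → d ∈ D
    owner∈D (inj₁ (d∈ , _)) = D₁⊆D d∈
    owner∈D (inj₂ (d∈ , _)) = D₂⊆D d∈

    owner-unique : ∀ {d d′ v} → Owns d v → Owns d′ v → d ≡ d′
    owner-unique (inj₁ (_ , refl)) (inj₁ (_ , refl)) = refl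
    owner-unique (inj₁ (d∈ , refl)) (inj₂ (d′∈ , w , w∈ , w~v)) = pn-only w∈ (D₁⊆D d∈) w~v
    owner-unique (inj₂ (d∈ , w , w∈ , w~v)) (inj₁ (d′∈ , refl)) = ≡.sym (pn-only w∈ (D₁⊆D d′∈) w~v)
    owner-unique (inj₂ (d∈ , w , w∈ , w~v)) (inj₂ (d′∈ , w′ , w′∈ , w′~v)) =
      private-neighbourhoods-disjoint d∈ d′∈ w∈ w′∈ w~v w′~v

    -- By (a) the class of a vertex in `D₂` is a single neighbourhood, which lies on one side of the
    -- bipartition.
    owned-independent : ∀ {d u v} → Owns d u → Owns d v → ¬ Adj G u v
    owned-independent (inj₁ (_ , refl)) (inj₁ (_ , refl)) u~v = Adj-irrefl u~v
    owned-independent (inj₁ (d∈ , _)) (inj₂ (d∈′ , _)) _ = disjoint d∈ d∈′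
    owned-independent (inj₂ (d∈′ , _)) (inj₁ (d∈ , _)) _ = disjoint d∈ d∈′
    owned-independent (inj₂ (d∈ , w , w∈ , w~u)) (inj₂ (_ , w′ , w′∈ , w′~v)) u~v
      with private-unique d∈ w∈ w′∈
    ... | refl = BoolP.not-¬ (bip (Adj-sym w~u)) (trans (bip u~v) (cong not (bip (Adj-sym w′~v))))

    color : Fin n → Fin (suc ∣ D ∣)
    color v with any? (λ d → Owns? d v)
    ... | yes (d , o) = suc (index D (owner∈D o))
    ... | no _ = zero

    color-owned : ∀ {d v} (o : Owns d v) (d∈ : d ∈ D) → color v ≡ suc (index D d∈)
    color-owned {d} {v} o d∈ with any? (λ d → Owns? d v)
    ... | yes (d′ , o′) with owner-unique o o′
    ... | refl = cong (suc ∘ index D) (∈-irrelevant (owner∈D o′) d∈)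
    color-owned {d} {v} o d∈ | no ∄ = contradiction (d , o) ∄

    color-suc⁻ : ∀ {d v} (d∈ : d ∈ D) → color v ≡ suc (index D d∈) → Owns d v
    color-suc⁻ {d} {v} d∈ e with any? (λ d → Owns? d v)
    ... | yes (d′ , o) = subst (λ d → Owns d v) (index-injective D (owner∈D o) d∈ (suc-injective e)) o

    isTDColoring : IsTDColoring G color
    isTDColoring = proper , dominates
      where
      unowned-independent : ∀ {u v} → ¬ (∃ λ d → Owns d u) → ¬ (∃ λ d → Owns d v) → ¬ Adj G u v
      unowned-independent {u} {v} ¬u ¬v u~v =
        condC u v (λ u∈ → ¬u (u , inj₁ (u∈ , refl))) ns-u (λ v∈ → ¬v (v , inj₁ (v∈ , refl))) ns-v u~v
        where
        ns-u : ¬ InNS G D D₂ u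
        -- The closed neighbourhood also contains `S`: if `u` is itself a private neighbour, then
        -- `v` is adjacent to it and therefore owned.
        ns-u (s , (d , d∈ , s∈) , inj₁ refl) = ¬v (d , inj₂ (d∈ , s , s∈ , u~v))
        ns-u (s , (d , d∈ , s∈) , inj₂ s~u) = ¬u (d , inj₂ (d∈ , s , s∈ , s~u))
        ns-v : ¬ InNS G D D₂ v
        ns-v (s , (d , d∈ , s∈) , inj₁ refl) = ¬u (d , inj₂ (d∈ , s , s∈ , Adj-sym u~v))
        ns-v (s , (d , d∈ , s∈) , inj₂ s~v) = ¬v (d , inj₂ (d∈ , s , s∈ , s~v))
      proper : IsProper G color
      proper u v u~v e with any? (λ d → Owns? d u)
      ... | yes (d , o) = owned-independent o (color-suc⁻ (owner∈D o) (≡.sym e)) u~v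
      ... | no ¬u with any? (λ d → Owns? d v)
      ... | no ¬v = unowned-independent ¬u ¬v u~v
      dominates : ∀ v → Σ (Fin (suc ∣ D ∣)) λ i →
        (Σ (Fin n) λ w → color w ≡ i) × (∀ w → color w ≡ i → Adj G v w)
      dominates v with dominator v
      ... | inj₁ (d , d∈ , v~d) = suc (index D (D₁⊆D d∈)) , (d , color-owned (inj₁ (d∈ , refl)) (D₁⊆D d∈)) , full
        where
        full : ∀ w → color w ≡ suc (index D (D₁⊆D d∈)) → Adj G v w
        full w e with color-suc⁻ (D₁⊆D d∈) e
        ... | inj₁ (_ , refl) = v~d
        ... | inj₂ (d∈D₂ , _) = contradiction d∈D₂ (disjoint d∈)
      ... | inj₂ (d , d∈ , v∈) =
        suc (index D (D₂⊆D d∈)) , (d , color-owned (inj₂ (d∈ , v , v∈ , pn⇒Adj v∈)) (D₂⊆D d∈)) , full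
        where
        full : ∀ w → color w ≡ suc (index D (D₂⊆D d∈)) → Adj G v w
        full w e with color-suc⁻ (D₂⊆D d∈) e
        ... | inj₁ (d∈D₁ , _) = contradiction d∈ (disjoint d∈D₁)
        ... | inj₂ (_ , x , x∈ , x~w) = subst (λ x → Adj G x w) (private-unique d∈ x∈ v∈) x~w

-- Colorings with as many colors as an open packing has vertices

  module PackedColoring {k : ℕ} (2≤n : 2 ≤ n) (conn : Connected G) (C₄-free : C₄-Free)
    (c : Fin n → Fin k) (isTDColoring : IsTDColoring G c)
    {Y : Subset n} (pack : OpenPacking Y) (k≤∣Y∣ : k ≤ ∣ Y ∣)
    where

    seen : Fin n → Fin k
    seen v = proj₁ (proj₂ isTDColoring v)

    seen-used : ∀ v → ∃ λ w → c w ≡ seen v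
    seen-used v = proj₁ (proj₂ (proj₂ isTDColoring v))

    seen-adj : ∀ {v w} → c w ≡ seen v → Adj G v w
    seen-adj {v} {w} = proj₂ (proj₂ (proj₂ isTDColoring v)) w

    seen-injective : ∀ {v w} → v ∈ Y → w ∈ Y → seen v ≡ seen w → v ≡ w
    seen-injective {v} v∈ w∈ e = let z , cz = seen-used v in
      pack v∈ w∈ (seen-adj cz) (seen-adj (trans cz e))

    abstract
      -- The map `seen` is injective on `Y`, which has at least as many vertices as there are
      -- colors, so no color can be missed.
      watcher : ∀ i → ∃ λ y → y ∈ Y × seen y ≡ i
      watcher i = decidable-stable (any? λ y → (y ∈? Y) ×-dec (seen y ≟ i)) λ ∄ →
        ℕ.<⇒≱ (ℕ.<-≤-trans (subst (∣ ⊤ - i ∣ <_) (∣⊤∣≡n k) (x∈p⇒∣p-x∣<∣p∣ (∈⊤ {x = i}))) k≤∣Y∣)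
          (injectiveOn⇒∣p∣≤∣q∣ Y (⊤ - i) seen
            (λ {y} y∈ → x∈p∧x≢y⇒x∈p-y ∈⊤ (λ e → ∄ (y , y∈ , e))) seen-injective)

    y : Fin k → Fin n
    y i = proj₁ (watcher i)

    y-adj⁺ : ∀ {i v} → c v ≡ i → Adj G (y i) v
    y-adj⁺ {i} e = seen-adj (trans e (≡.sym (proj₂ (proj₂ (watcher i)))))

    y-injective : ∀ {i j} → y i ≡ y j → i ≡ j
    y-injective {i} {j} e =
      trans (≡.sym (proj₂ (proj₂ (watcher i)))) (trans (cong seen e) (proj₂ (proj₂ (watcher j))))

    -- Hence N(y i) is exactly the class of the color i.
    y-adj⁻ : ∀ {i v} → Adj G (y i) v → c v ≡ i
    y-adj⁻ {i} {v} a = y-injective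
      (pack (proj₁ (proj₂ (watcher (c v)))) (proj₁ (proj₂ (watcher i))) (y-adj⁺ refl) a)

    -- The vertex `y (partner i)` sees the whole class of `y i`, in particular `y i` itself. This
    -- matches the vertices `y i` in adjacent pairs.
    partner : Fin k → Fin k
    partner i = c (y i)

    partner-involutive : ∀ i → partner (partner i) ≡ i
    partner-involutive i = y-adj⁻ (Adj-sym (y-adj⁺ refl))

    Big : Fin k → Set
    Big i = ∃ λ a → ∃ λ b → a ≢ b × c a ≡ i × c b ≡ i

    Big? : ∀ i → Dec (Big i)
    Big? i = any? λ a → any? λ b → ¬? (a ≟ b) ×-dec ((c a ≟ i) ×-dec (c b ≟ i))

    small-unique : ∀ {i a b} → ¬ Big i → c a ≡ i → c b ≡ i → a ≡ b
    small-unique {a = a} {b} ¬big ea eb = decidable-stable (a ≟ b) λ a≢b → ¬big (a , b , a≢b , ea , eb)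

    small⇒y-partner : ∀ {v} → ¬ Big (c v) → v ≡ y (partner (c v))
    small⇒y-partner ¬big = small-unique ¬big refl (partner-involutive _)

    -- If `seen v` is big, then `v` and `y (seen v)` have two common neighbours, so they coincide
    -- and `seen v` is `partner i`. If it is not, `v` is adjacent to `y (partner (seen v))`, so
    -- `seen v` is again `partner i`, which is big.
    big-partner⇒small : ∀ {i v} → Big (partner i) → c v ≡ i → v ≡ y (partner i)
    big-partner⇒small {i} {v} big cv with Big? (seen v)
    ... | yes (a , b , a≢b , ca , cb) = trans v≡y (cong y (trans (≡.sym (partner-involutive (seen v))) (cong partner
            (trans (cong c (≡.sym v≡y)) cv))))
      where
      v≡y : v ≡ y (seen v)
      v≡y = C₄-free (seen-adj ca) (seen-adj cb) (y-adj⁺ ca) (y-adj⁺ cb) a≢b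
    ... | no ¬big = contradiction (subst Big m≡ big) ¬big
      where
      m≡ : partner i ≡ seen v
      m≡ = trans (cong partner (trans (≡.sym cv) (y-adj⁻ (Adj-sym (seen-adj (partner-involutive (seen v)))))))
             (partner-involutive (seen v))

    not-both-big : ∀ {i} → Big i → ¬ Big (partner i)
    not-both-big (a , b , a≢b , ca , cb) big =
      a≢b (trans (big-partner⇒small big ca) (≡.sym (big-partner⇒small big cb)))

    -- The matched vertices `a` and `b` have no neighbours but each other, so by connectedness there
    -- are no further vertices.
    both-small⇒n≡2 : ∀ {i} → ¬ Big i → ¬ Big (partner i) → n ≡ 2
    both-small⇒n≡2 {i} ¬big ¬big′ = ℕ.≤-antisym n≤2 2≤n
      where
      a = y i
      b = y (partner i)
      stay : ∀ {u v} → Walk G u v → u ∈ ⁅ a ⁆ ∪ ⁅ b ⁆ → v ∈ ⁅ a ⁆ ∪ ⁅ b ⁆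
      stay here u∈ = u∈
      stay (step {w = w} u~w W) u∈ with x∈p∪q⁻ ⁅ a ⁆ ⁅ b ⁆ u∈
      ... | inj₁ u∈a with x∈⁅y⁆⇒x≡y a u∈a
      ... | refl = stay W (q⊆p∪q ⁅ a ⁆ ⁅ b ⁆ (subst (_∈ ⁅ b ⁆)
              (≡.sym (small-unique ¬big (y-adj⁻ u~w) (partner-involutive i))) (x∈⁅x⁆ b)))
      stay (step {w = w} u~w W) u∈ | inj₂ u∈b with x∈⁅y⁆⇒x≡y b u∈b
      ... | refl = stay W (p⊆p∪q ⁅ b ⁆ (subst (_∈ ⁅ a ⁆)
              (≡.sym (small-unique ¬big′ (y-adj⁻ u~w) refl)) (x∈⁅x⁆ a)))
      n≤2 : n ≤ 2
      n≤2 = begin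
        n                         ≡⟨ ∣⊤∣≡n n ⟨
        ∣ ⊤ {n} ∣                 ≤⟨ p⊆q⇒∣p∣≤∣q∣ {p = ⊤} (λ {v} _ → stay (conn a v) (p⊆p∪q ⁅ b ⁆ (x∈⁅x⁆ a))) ⟩
        ∣ ⁅ a ⁆ ∪ ⁅ b ⁆ ∣         ≤⟨ ∣p∪q∣≤∣p∣+∣q∣ ⁅ a ⁆ ⁅ b ⁆ ⟩
        ∣ ⁅ a ⁆ ∣ + ∣ ⁅ b ⁆ ∣     ≡⟨ ≡.cong₂ _+_ (∣⁅x⁆∣≡1 a) (∣⁅x⁆∣≡1 b) ⟩
        2                         ∎
        where open ℕ.≤-Reasoning

    module _ (n≢2 : n ≢ 2) where

      partner-big : ∀ {i} → ¬ Big i → Big (partner i)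
      partner-big {i} ¬big = decidable-stable (Big? (partner i)) λ ¬big′ → n≢2 (both-small⇒n≡2 ¬big ¬big′)

      -- Centers are the vertices alone in their class. A big class is the leaf set of one star,
      -- centered at the `y` of its color.
      ctr : Fin n → Fin n
      ctr v = if ⌊ Big? (c v) ⌋ then y (c v) else v

      ctr-big : ∀ {v} → Big (c v) → ctr v ≡ y (c v)
      ctr-big {v} big with Big? (c v)
      ... | yes _ = refl
      ... | no ¬big = contradiction big ¬big

      ctr-small : ∀ {v} → ¬ Big (c v) → ctr v ≡ v
      ctr-small {v} ¬big with Big? (c v)
      ... | yes big = contradiction big ¬big
      ... | no _ = refl

      center⇒small : ∀ {v} → v ≡ ctr v → ¬ Big (c v)
      center⇒small e big =
        Adj-irrefl (subst (λ x → Adj G x _) (≡.sym (trans e (ctr-big big))) (y-adj⁺ refl))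

      big⇒noncenter : ∀ {v} → Big (c v) → v ≢ ctr v
      big⇒noncenter big e = center⇒small e big

      -- Being alone in its class, `u` is the `y` of the partner color, so its neighbours form that
      -- class, which is big.
      center-adj⇒same-star : ∀ {u w} → ¬ Big (c u) → Adj G u w → ctr w ≡ u
      center-adj⇒same-star {u} {w} ¬big u~w =
        trans (ctr-big (subst Big (≡.sym cw) (partner-big ¬big))) (trans (cong y cw) (≡.sym (small⇒y-partner ¬big)))
        where
        cw : c w ≡ partner (c u)
        cw = y-adj⁻ (subst (λ x → Adj G x w) (small⇒y-partner ¬big) u~w)

      stars : StarDecomposition G
      stars = ctr , idem , within , order≥3 , between , support
        where
        idem : ∀ v → ctr (ctr v) ≡ ctr v
        idem v with Big? (c v)
        ... | yes big = ctr-small (not-both-big big)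
        ... | no ¬big = ctr-small ¬big
        within : ∀ u w → ctr u ≡ ctr w →
          (Adj G u w → (u ≡ ctr u × w ≢ ctr w) ⊎ (w ≡ ctr w × u ≢ ctr u)) ×
          ((u ≡ ctr u × w ≢ ctr w) ⊎ (w ≡ ctr w × u ≢ ctr u) → Adj G u w)
        within u w e = to , from
          where
          to : Adj G u w → (u ≡ ctr u × w ≢ ctr w) ⊎ (w ≡ ctr w × u ≢ ctr u)
          to u~w with toSum (Big? (c u)) | toSum (Big? (c w))
          -- Leaves of one star share their color, so properness excludes an edge.
          ... | inj₁ bu | inj₁ bw = contradiction (y-injective (trans (≡.sym (ctr-big bu)) (trans e (ctr-big bw))))
                                    (proj₁ isTDColoring u w u~w)
          ... | inj₁ bu | inj₂ ¬bw = inj₂ (≡.sym (ctr-small ¬bw) , big⇒noncenter bu)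
          ... | inj₂ ¬bu | inj₁ bw = inj₁ (≡.sym (ctr-small ¬bu) , big⇒noncenter bw)
          ... | inj₂ ¬bu | inj₂ ¬bw = contradiction
                  (subst (Adj G u) (trans (≡.sym (ctr-small ¬bw)) (trans (≡.sym e) (ctr-small ¬bu))) u~w) Adj-irrefl
          leaf-adj : ∀ {v x} → x ≡ ctr x → v ≢ ctr v → ctr v ≡ ctr x → Adj G x v
          leaf-adj {v} {x} x-ctr v-non e′ with toSum (Big? (c v))
          ... | inj₁ big = subst (λ z → Adj G z v) (trans (≡.sym (ctr-big big)) (trans e′ (≡.sym x-ctr))) (y-adj⁺ refl)
          ... | inj₂ ¬big = contradiction (≡.sym (ctr-small ¬big)) v-non
          from : (u ≡ ctr u × w ≢ ctr w) ⊎ (w ≡ ctr w × u ≢ ctr u) → Adj G u w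
          from (inj₁ (u-ctr , w-non)) = leaf-adj u-ctr w-non (≡.sym e)
          from (inj₂ (w-ctr , u-non)) = Adj-sym (leaf-adj w-ctr u-non e)
        order≥3 : ∀ x → ctr x ≡ x → Σ (Fin n) λ a → Σ (Fin n) λ b →
          a ≢ b × a ≢ x × b ≢ x × ctr a ≡ x × ctr b ≡ x
        order≥3 x e =
          let ¬big = center⇒small (≡.sym e)
              a , b , a≢b , ca , cb = partner-big ¬big
              x-adj : ∀ {v} → c v ≡ partner (c x) → Adj G x v
              x-adj cv = subst (λ z → Adj G z _) (≡.sym (small⇒y-partner ¬big)) (y-adj⁺ cv)
          in a , b , a≢b , Adj⇒≢ (x-adj ca) , Adj⇒≢ (x-adj cb) ,
             center-adj⇒same-star ¬big (x-adj ca) , center-adj⇒same-star ¬big (x-adj cb)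
        between : ∀ u w → ctr u ≢ ctr w → Adj G u w → u ≢ ctr u × w ≢ ctr w
        between u w ≢ u~w =
          (λ e → ≢ (trans (≡.sym e) (≡.sym (center-adj⇒same-star (center⇒small e) u~w)))) ,
          (λ e → ≢ (trans (center-adj⇒same-star (center⇒small e) (Adj-sym u~w)) e))
        support : ∀ x → ctr x ≡ x → IsSupport G x
        -- The neighbourhood of `y (c x)` is the class of `x`, that is `x` alone, so `y (c x)` is a
        -- leaf.
        support x e = y (c x) , Adj-sym (y-adj⁺ refl) ,
          trans (cong ∣_∣ (singleton-unique (∈N⁺ (y-adj⁺ {v = x} refl))
            (λ z∈ → small-unique (center⇒small (≡.sym e)) (y-adj⁻ (∈N⁻ z∈)) refl))) (∣⁅x⁆∣≡1 x)

theorem4 : ∀ {n : ℕ} (T : Graph n) → 2 ≤ n → IsTree T → ¬ InFamilyT T →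
    ∀ (k g : ℕ) → IsChiTD T k → IsGammaT T g →
    (k ≡ suc g ⇔ Σ (Subset n) λ D → IsMinTDSet T D × Σ (Subset n) λ D₁ → Σ (Subset n) λ D₂ →
    IsPartition T D D₁ D₂ × CondA T D D₂ × CondB T D D₂ × CondC T D D₁ D₂)
theorem4 {n@(suc _)} T 2≤n tree T∉𝒯 k g ((c , isTD) , k-least) (D₀ , (td₀ , least) , ∣D₀∣≡g) = mk⇔ to from
  where
  spanning : Spanning T
  spanning = tree⇒spanning T tree zero
  side = proj₁ (tree⇒bipartition T spanning)
  bip = proj₂ (tree⇒bipartition T spanning)
  C₄-free : C₄-Free T
  C₄-free = tree⇒C₄-free T spanning
  to : k ≡ suc g → GoodPartition T
  to refl = FromColoring.goodPartition T zero side bip C₄-free c isTD td₀ least ∣D₀∣≡g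
  g≤k : g ≤ k
  g≤k = subst (_≤ k) ∣D₀∣≡g (TDColoring⇒γ≤k T zero isTD (td₀ , least))
  k≢g : k ≢ g
  -- With only `g` colors, the packing has at least as many vertices as there are colors, which puts
  -- the tree in 𝒯.
  k≢g refl =
    let E , tdE , Y , ∣E∣≤∣Y∣ , pack = tree⇒openPacking T spanning
          (λ v → let d , _ , v~d = Nonempty⇒Dominated T (td₀ v) in d , v~d)
        k≤∣Y∣ = subst (_≤ ∣ Y ∣) ∣D₀∣≡g (ℕ.≤-trans (least E tdE) ∣E∣≤∣Y∣)
    in T∉𝒯 (inj₂ (PackedColoring.stars T 2≤n (proj₁ tree) C₄-free c isTD pack k≤∣Y∣ (T∉𝒯 ∘ inj₁)))
  from : GoodPartition T → k ≡ suc g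
  from (D , minD , D₁ , D₂ , (∪≡ , ∩≡) , a , b , c′) = ℕ.≤-antisym
    (ℕ.≤-trans (k-least _ _ (ToColoring.isTDColoring T side bip minD ∪≡ ∩≡ a b c′))
      (s≤s (subst (∣ D ∣ ≤_) ∣D₀∣≡g (proj₂ minD D₀ td₀))))
    -- The bound `g ≤ k` is strict because the tree is not in 𝒯.
    (ℕ.≤∧≢⇒< g≤k (k≢g ∘ ≡.sym))
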